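{- Let $K$ be a $k$-dimensional USO and $h\in[k]$. Performing a partial swap on $K$ in dimension $h$ does not change the set of $h$-phases; that is, if $K'$ is the USO obtained from $K$ by the partial swap in dimension $h$, then the $h$-phases of $K'$ and the $h$-phases of $K$ are the same sets of $h$-edges of $Q_k$.
   Context: $[k]=\{1,\ldots,k\}$. $Q_k$ is the $k$-dimensional hypercube graph with vertex set $\{0,1\}^k$; $v\oplus i$ denotes the neighbor of $v$ differing from $v$ exactly in coordinate $i$, and $\{v,v\oplus i\}$ is called an $i$-edge. An orientation $O$ of $Q_k$ directs every edge; it is identified with the function $O:\{0,1\}^k\to\{0,1\}^k$ where $O(v)_i=1$ if the edge $\{v,v\oplus i\}$ is directed upwards (from its endpoint with $i$-th coordinate $0$ to its endpoint with $i$-th coordinate $1$) and $O(v)_i=0$ if it is directed downwards (so $O(v)_i=O(v\oplus i)_i$). A face is the subgraph induced by all vertices that agree with a fixed string $f\in\{0,1,*\}^k$ on the non-$*$ positions. $O$ is a Unique Sink Orientation (USO) if every face contains exactly one vertex with no outgoing edges inside that face. Phases. Flipping a set of edges means reversing their directions. The $i$-phases of a USO $O$ are the minimal equivalence classes of the set of $i$-edges such that flipping any collection of these classes preserves the USO property; equivalently (by a known result of Schurr) they are the blocks of the unique partition of the set of (undirected) $i$-edges such that, for every set $P$ of $i$-edges, flipping $P$ in $O$ gives a USO if and only if $P$ is a union of blocks. Partial swap. For a USO $K$ of $Q_k$ and $h\in[k]$, the partial swap of $K$ in dimension $h$ is the orientation $K'$ with $K'(v)=K(v\oplus h)$ if $K(v)_h=1$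 (the $h$-edge at $v$ is upwards) and $K'(v)=K(v)$ otherwise. It is known that $K'$ is a USO. -}

module Defs where

open import Data.Bool using (Bool; true; false; not; T; if_then_else_)
open import Data.Fin using (Fin)
open import Data.Maybe using (Maybe; just; nothing)
open import Data.Nat using (ℕ)
open import Data.Product using (Σ-syntax; ∃-syntax; ∃!; _×_)
open import Data.Vec using (Vec; lookup; _[_]≔_; _[_]%=_)
open import Data.Vec.Properties using (lookup∘update)
open import Function using (_⇔_; _∘_)
open import Level using (0ℓ) renaming (suc to lsuc)
open import Relation.Binary using (Rel; IsDecEquivalence; _Respects_)
open import Relation.Binary.PropositionalEquality using (_≡_)
open import Relation.Nullary using (¬_)

Vertex : ℕ → Set
Vertex k = Vec Bool k

infixl 6 _⊕_

_⊕_ : ∀ {k} → Vertex k → Fin k → Vertex k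
v ⊕ i = v [ i ]%= not

-- `lookup (O v) i ≡ true` says that the i-edge at v points from its endpoint
-- with i-th coordinate `false` to the one with i-th coordinate `true`.  Only
-- the maps satisfying `IsOrientation` describe orientations of the cube.
OrientationMap : ℕ → Set
OrientationMap k = Vertex k → Vec Bool k

IsOrientation : ∀ {k} → OrientationMap k → Set
IsOrientation O = ∀ v i → lookup (O v) i ≡ lookup (O (v ⊕ i)) i

-- Upwards and at the lower endpoint, or downwards and at the upper endpoint.
Outgoing : ∀ {k} → OrientationMap k → Vertex k → Fin k → Set
Outgoing O v i = lookup (O v) i ≡ not (lookup v i)

-- Strings over {0,1,*}, with `nothing` for *.
Face : ℕ → Set
Face k = Vec (Maybe Bool) k

_∈ᶠ_ : ∀ {k} → Vertex k → Face k → Set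
v ∈ᶠ f = ∀ i b → lookup f i ≡ just b → lookup v i ≡ b

IsSinkOf : ∀ {k} → OrientationMap k → Face k → Vertex k → Set
IsSinkOf O f v = v ∈ᶠ f × (∀ i → lookup f i ≡ nothing → ¬ Outgoing O v i)

IsUSO : ∀ {k} → OrientationMap k → Set
IsUSO {k} O = IsOrientation O × (∀ (f : Face k) → ∃! _≡_ (IsSinkOf O f))

-- An undirected i-edge is represented by its endpoint with i-th coordinate 0.
record Edge {k : ℕ} (i : Fin k) : Set where
  constructor mkEdge
  field
    lower    : Vertex k
    .isLower : lookup lower i ≡ false

-- The i-edge {v, v ⊕ i}.
edgeAt : ∀ {k} → Vertex k → (i : Fin k) → Edge i
edgeAt v i = mkEdge (v [ i ]≔ false) (lookup∘update i v false)

EdgeSet : ∀ {k} → Fin k → Set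
EdgeSet i = Edge i → Bool

flip : ∀ {k} → OrientationMap k → (i : Fin k) → EdgeSet i → OrientationMap k
flip O i P v = if P (edgeAt v i) then O v [ i ]%= not else O v

-- A set of i-edges is a union of blocks when it contains the whole block of
-- each of its members.
IsUnionOfBlocks : ∀ {k} {i : Fin k} → Rel (Edge i) 0ℓ → EdgeSet i → Set
IsUnionOfBlocks _~_ P = (T ∘ P) Respects _~_

-- Partitions of the i-edges are given as decidable equivalence relations.
-- Decidability loses nothing, the edges being finite in number, and makes the
-- blocks themselves `EdgeSet`s, so that at most one partition qualifies.
record IsPhasePartition {k : ℕ} (O : OrientationMap k) (i : Fin k)
                        (_~_ : Rel (Edge i) 0ℓ) : Set where
  field
    isDecEquivalence : IsDecEquivalence _~_
    flip-uso⇔union   : ∀ (P : EdgeSet i) →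
                       IsUSO (flip O i P) ⇔ IsUnionOfBlocks _~_ P

IsBlock : ∀ {k} {i : Fin k} → Rel (Edge i) 0ℓ → EdgeSet i → Set
IsBlock _~_ B = ∃[ e ] (∀ e′ → T (B e′) ⇔ e ~ e′)

IsPhase : ∀ {k} → OrientationMap k → (i : Fin k) → EdgeSet i → Set (lsuc 0ℓ)
IsPhase O i B =
  Σ[ R ∈ Rel (Edge i) 0ℓ ] (IsPhasePartition O i R × IsBlock R B)

-- For a general orientation the result need not satisfy `IsOrientation`; for
-- a unique sink orientation it does.
partialSwap : ∀ {k} → OrientationMap k → Fin k → OrientationMap k
partialSwap K h v = if lookup (K v) h then K (v ⊕ h) else K v

-- Szabó–Welzl: O is a USO iff any two distinct vertices differ in a coordinate
-- whose edges at the two vertices point the same way.  So, for a USO K,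
-- flipping a set P of h-edges gives a USO iff P does not distinguish the h-edges
-- at v and w whenever h is the only coordinate separating v from w.  Along such
-- a pair both h-edges point the same way, so the partial swap either fixes both
-- K v and K w or replaces both by the values at v ⊕ h and w ⊕ h, which lie on
-- the same h-edges.  Hence K and its partial swap admit the same flips.

module Submission where

open import Data.Bool using (Bool; true; false; not; _xor_; if_then_else_)
open import Data.Bool.Properties using (_≟_; ¬-not; not-¬; not-involutive)
open import Data.Fin using (Fin; zero; suc)
import Data.Fin as Fin
open import Data.Fin.Properties using (any?)
open import Data.Maybe using (Maybe; just; nothing)
open import Data.Nat using (ℕ)
open import Data.Product using (∃; ∃-syntax; ∃!; _×_; _,_; proj₁; proj₂)
open import Data.Sum using (_⊎_; inj₁; inj₂)
open import Data.Vec using (Vec; []; _∷_; lookup; map; replicate; tabulate; _[_]≔_)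
open import Data.Vec.Properties
  using (lookup∘update; lookup∘update′; lookup∘updateAt; lookup∘updateAt′;
         lookup∘tabulate; lookup-map; lookup-replicate; updateAt-updateAt; updateAt-id-local)
open import Data.Vec.Relation.Binary.Pointwise.Extensional using (ext; Pointwise-≡⇒≡)
open import Function using (_⇔_; mk⇔; Equivalence; _∘_)
import Function.Properties.Equivalence as ⇔
open import Relation.Binary.PropositionalEquality
  using (_≡_; _≢_; refl; sym; trans; cong; cong₂; subst; subst₂; module ≡-Reasoning)
open import Relation.Nullary using (yes; no; contradiction)
open import Relation.Nullary.Decidable using (_×-dec_; ¬?)
open import Defs

private
  variable
    k : ℕ

-- Booleans, vectors and induction on the cube.

xor-≢-≡ : ∀ a b x y → a ≢ b → x ≡ y → x xor a ≢ y xor b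
xor-≢-≡ false false _     _ a≢b _    = contradiction refl a≢b
xor-≢-≡ true  true  _     _ a≢b _    = contradiction refl a≢b
xor-≢-≡ false true  false _ _   refl = λ ()
xor-≢-≡ false true  true  _ _   refl = λ ()
xor-≢-≡ true  false false _ _   refl = λ ()
xor-≢-≡ true  false true  _ _   refl = λ ()

xor-≢-≢ : ∀ a b x y → a ≢ b → x ≢ y → x xor a ≡ y xor b
xor-≢-≢ false false _     _     a≢b _   = contradiction refl a≢b
xor-≢-≢ true  true  _     _     a≢b _   = contradiction refl a≢b
xor-≢-≢ _     _     false false _   x≢y = contradiction refl x≢y
xor-≢-≢ _     _     true  true  _   x≢y = contradiction refl x≢y
xor-≢-≢ false true  false true  _   _   = refl
xor-≢-≢ false true  true  false _   _   = refl
xor-≢-≢ true  false false true  _   _   = refl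
xor-≢-≢ true  false true  false _   _   = refl

xor-cancelʳ : ∀ a p q → p xor a ≡ q xor a → p ≡ q
xor-cancelʳ a     false false _  = refl
xor-cancelʳ a     true  true  _  = refl
xor-cancelʳ false false true  ()
xor-cancelʳ true  false true  ()
xor-cancelʳ false true  false ()
xor-cancelʳ true  true  false ()

lookup-ext : ∀ {A : Set} {v w : Vec A k} → (∀ i → lookup v i ≡ lookup w i) → v ≡ w
lookup-ext eq = Pointwise-≡⇒≡ (ext eq)

distinct-indices : ∀ {A : Set} (v w : Vec A k) {i j} →
                   lookup v i ≡ lookup w i → lookup v j ≢ lookup w j → i ≢ j
distinct-indices v w eq ≢ⱼ refl = ≢ⱼ eq

lookup-⊕ : ∀ (v : Vertex k) i → lookup (v ⊕ i) i ≡ not (lookup v i)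
lookup-⊕ v i = lookup∘updateAt i v

lookup-⊕′ : ∀ (v : Vertex k) {i j} → j ≢ i → lookup (v ⊕ i) j ≡ lookup v j
lookup-⊕′ v {i} {j} j≢i = lookup∘updateAt′ j i j≢i v

⊕-involutive : ∀ (v : Vertex k) i → v ⊕ i ⊕ i ≡ v
⊕-involutive v i =
  trans (updateAt-updateAt i v) (updateAt-id-local i v (not-involutive _))

-- The cube is connected. This is applied to outmap patterns: it carries uniqueness from the zero
-- pattern to any other, one coordinate at a time.
⊕-connected : ∀ (Q : Vertex k → Set) → (∀ v i → Q v → Q (v ⊕ i)) →
              ∀ v w → Q v → Q w
⊕-connected Q step []      []      q = q
⊕-connected Q step (a ∷ v) (b ∷ w) q =
  ⊕-connected (Q ∘ (b ∷_)) (λ u i → step (b ∷ u) (suc i)) v w (head a b q)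
  where
  head : ∀ a b → Q (a ∷ v) → Q (b ∷ v)
  head false false q = q
  head true  true  q = q
  head false true  q = step (false ∷ v) zero q
  head true  false q = step (true ∷ v) zero q

-- Every face is obtained from vertices by gluing opposite facets. The tail of the string is brought
-- to a vertex first, so a free head splits directly into two vertices.
face-induction : ∀ (Q : Face k → Set) → (∀ v → Q (map just v)) →
                 (∀ f i → lookup f i ≡ nothing → (∀ b → Q (f [ i ]≔ just b)) → Q f) →
                 ∀ f → Q f
face-induction Q vertex split []      = vertex []
face-induction Q vertex split (x ∷ f) =
  face-induction (Q ∘ (x ∷_)) (head x) (λ g i → split (x ∷ g) (suc i)) f
  where
  head : ∀ x v → Q (x ∷ map just v)
  head (just b) v = vertex (b ∷ v)
  head nothing  v = split _ zero refl (λ b → vertex (b ∷ v))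

-- Outmaps on faces.

outmap : OrientationMap k → Vertex k → Fin k → Bool
outmap O v i = lookup (O v) i xor lookup v i

-- `outmap` is true exactly on outgoing edges. So `v` becomes a sink of `f` once all edges in the
-- coordinates where `A` is true are reversed.
record HasOutmap (O : OrientationMap k) (A : Vec Bool k) (f : Face k) (v : Vertex k) : Set where
  constructor _,_
  field
    member : v ∈ᶠ f
    agrees : ∀ i → lookup f i ≡ nothing → outmap O v i ≡ lookup A i

open HasOutmap

EqualOff : Fin k → Vec Bool k → Vec Bool k → Set
EqualOff i A B = ∀ j → j ≢ i → lookup A j ≡ lookup B j

free-in-facet⇒≢ : ∀ (f : Face k) i c j → lookup (f [ i ]≔ just c) j ≡ nothing → j ≢ i
free-in-facet⇒≢ f i c j free refl with () ← trans (sym (lookup∘update i f (just c))) free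

module _ (O : OrientationMap k) where

  -- Coordinate `i` is fixed on the facet, so the pattern may change there freely.
  toFacet : ∀ {A B f v i c} → EqualOff i A B → lookup v i ≡ c →
            HasOutmap O A f v → HasOutmap O B (f [ i ]≔ just c) v
  toFacet {f = f} {v} {i} {c} A≈B vᵢ≡c (v∈f , out) = v∈facet , out′
    where
    v∈facet : v ∈ᶠ (f [ i ]≔ just c)
    v∈facet j b eq with j Fin.≟ i
    ... | no j≢i   = v∈f j b (trans (sym (lookup∘update′ j≢i f (just c))) eq)
    ... | yes refl with refl ← trans (sym (lookup∘update i f (just c))) eq = vᵢ≡c
    out′ : ∀ j → lookup (f [ i ]≔ just c) j ≡ nothing → outmap O v j ≡ _
    out′ j free =
      let j≢i = free-in-facet⇒≢ f i c j free in
      trans (out j (trans (sym (lookup∘update′ j≢i f (just c))) free)) (A≈B j j≢i)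

  -- Coordinate `i` becomes free again, so the new pattern has to be matched there separately.
  fromFacet : ∀ {A B f v i c} → EqualOff i A B → lookup f i ≡ nothing →
              outmap O v i ≡ lookup B i →
              HasOutmap O A (f [ i ]≔ just c) v → HasOutmap O B f v
  fromFacet {B = B} {f} {v} {i} {c} A≈B free outᵢ (v∈facet , out) = v∈f , out′
    where
    v∈f : v ∈ᶠ f
    v∈f j b eq with j Fin.≟ i
    ... | no j≢i   = v∈facet j b (trans (lookup∘update′ j≢i f (just c)) eq)
    ... | yes refl with () ← trans (sym free) eq
    out′ : ∀ j → lookup f j ≡ nothing → outmap O v j ≡ lookup B j
    out′ j freeⱼ with j Fin.≟ i
    ... | yes refl = outᵢ
    ... | no j≢i   =
      trans (out j (trans (lookup∘update′ j≢i f (just c)) freeⱼ)) (A≈B j j≢i)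

  facet-coordinate : ∀ f i {A v c} → HasOutmap O A (f [ i ]≔ just c) v → lookup v i ≡ c
  facet-coordinate f i {c = c} v-out = member v-out i c (lookup∘update i f (just c))

  UniqueOutmap : Vec Bool k → Set
  UniqueOutmap A = ∀ f → ∃! _≡_ (HasOutmap O A f)

  -- The A-vertex u of f lies in one facet along i; the vertex realising A on the
  -- opposite facet cannot realise A at i as well, and so realises A ⊕ i on f.
  uniqueOutmap-⊕ : ∀ A i → UniqueOutmap A → UniqueOutmap (A ⊕ i)
  uniqueOutmap-⊕ A i unique f with lookup f i in fᵢ
  ... | just c =
    let v , (v∈f , out) , uniq = unique f in
    v , (v∈f , λ j free → trans (out j free) (A≈ j (≢i j free))) ,
    λ (w∈f , out′) → uniq (w∈f , λ j free → trans (out′ j free) (sym (A≈ j (≢i j free))))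
    where
    A≈ : EqualOff i A (A ⊕ i)
    A≈ j j≢i = sym (lookup-⊕′ A j≢i)
    ≢i : ∀ j → lookup f j ≡ nothing → j ≢ i
    ≢i j free refl with () ← trans (sym fᵢ) free
  ... | nothing = v , fromFacet A≈ fᵢ vᵢ-out v-out , uniq
    where
    A≈ : EqualOff i A (A ⊕ i)
    A≈ j j≢i = sym (lookup-⊕′ A j≢i)
    u : Vertex k
    u = proj₁ (unique f)
    u-out : HasOutmap O A f u
    u-out = proj₁ (proj₂ (unique f))
    c : Bool
    c = lookup u i
    opposite : ∃! _≡_ (HasOutmap O A (f [ i ]≔ just (not c)))
    opposite = unique (f [ i ]≔ just (not c))
    v : Vertex k
    v = proj₁ opposite
    v-out : HasOutmap O A (f [ i ]≔ just (not c)) v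
    v-out = proj₁ (proj₂ opposite)
    vᵢ-out : outmap O v i ≡ lookup (A ⊕ i) i
    vᵢ-out = trans (¬-not λ eq →
        not-¬ (cong (λ x → lookup x i) (sym (proj₂ (proj₂ (unique f))
                 (fromFacet (λ _ _ → refl) fᵢ eq v-out))))
              (facet-coordinate f i v-out))
      (sym (lookup-⊕ A i))
    uniq : ∀ {w} → HasOutmap O (A ⊕ i) f w → v ≡ w
    uniq {w} w-out with lookup w i ≟ c
    ... | no wᵢ≢c  = proj₂ (proj₂ opposite) (toFacet (λ j → sym ∘ A≈ j) (¬-not wᵢ≢c) w-out)
    -- On the facet of `u` the patterns `A` and `A ⊕ i` impose the same condition, so `w` would be
    -- `u`, whose outmap at `i` is that of `A`.
    ... | yes wᵢ≡c = contradiction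
      (trans (agrees w-out i fᵢ) (lookup-⊕ A i))
      (not-¬ (subst (λ x → outmap O x i ≡ lookup A i) u≡w (agrees u-out i fᵢ)))
      where
      facet : ∃! _≡_ (HasOutmap O A (f [ i ]≔ just c))
      facet = unique (f [ i ]≔ just c)
      u≡w : u ≡ w
      u≡w = trans (sym (proj₂ (proj₂ facet) (toFacet (λ _ _ → refl) refl u-out)))
                  (proj₂ (proj₂ facet) (toFacet (λ j → sym ∘ A≈ j) wᵢ≡c w-out))

  sink⇔zeroOutmap : ∀ f v → IsSinkOf O f v ⇔ HasOutmap O (replicate k false) f v
  sink⇔zeroOutmap f v = mk⇔
    (λ (v∈f , sink) → v∈f , λ i free → trans (to _ _ (sink i free)) (sym (lookup-replicate i false)))
    (λ (v∈f , out) → v∈f , λ i free → from _ _ (trans (out i free) (lookup-replicate i false)))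
    where
    to : ∀ x a → x ≢ not a → x xor a ≡ false
    to false false _ = refl
    to true  true  _ = refl
    to false true  ≢ = contradiction refl ≢
    to true  false ≢ = contradiction refl ≢
    from : ∀ x a → x xor a ≡ false → x ≢ not a
    from false false _ ()
    from true  true  _ ()
    from false true  ()
    from true  false ()

  -- The Szabó-Welzl criterion.

  SeparatedAt : Vertex k → Vertex k → Fin k → Set
  SeparatedAt v w i = lookup v i ≢ lookup w i × lookup (O v) i ≡ lookup (O w) i

  -- Directions are compared here instead of outmaps: where the coordinates differ, equal directions
  -- mean that one edge leaves its endpoint and the other enters.
  Separating : Set
  Separating = ∀ v w → v ≢ w → ∃ (SeparatedAt v w)

  separated⇒outmap-≢ : ∀ v w {i} → SeparatedAt v w i → outmap O v i ≢ outmap O w i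
  separated⇒outmap-≢ _ _ (v≢w , Ov≡Ow) = xor-≢-≡ _ _ _ _ v≢w Ov≡Ow

  -- Unseparated v and w would realise the same outmap on the face they span.
  uso⇒separating : IsUSO O → Separating
  uso⇒separating (_ , unique) v w v≢w
    with any? (λ i → ¬? (lookup v i ≟ lookup w i) ×-dec (lookup (O v) i ≟ lookup (O w) i))
  ... | yes sep = sep
  ... | no ¬sep = contradiction
        (trans (sym (uniq (proj₁ span∋ , λ i _ → sym (lookup∘tabulate _ i))))
               (uniq (proj₂ span∋ , λ i free →
                 trans (sym (outmap-≡ i free)) (sym (lookup∘tabulate _ i)))))
        v≢w
    where
    zero-unique : UniqueOutmap (replicate k false)
    zero-unique f =
      let x , sink , uniq = unique f in
      x , Equivalence.to (sink⇔zeroOutmap f x) sink ,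
      λ {y} → uniq ∘ Equivalence.from (sink⇔zeroOutmap f y)

    common : Bool → Bool → Maybe Bool
    common false false = just false
    common true  true  = just true
    common _     _     = nothing

    common-just : ∀ a b {c} → common a b ≡ just c → a ≡ c × b ≡ c
    common-just false false refl = refl , refl
    common-just true  true  refl = refl , refl

    common-nothing : ∀ a b → common a b ≡ nothing → a ≢ b
    common-nothing false true  _ ()
    common-nothing true  false _ ()

    span : Face k
    span = tabulate λ i → common (lookup v i) (lookup w i)

    span∋ : v ∈ᶠ span × w ∈ᶠ span
    span∋ = (λ i b eq → proj₁ (agree i eq)) , (λ i b eq → proj₂ (agree i eq))
      where
      agree : ∀ i {b} → lookup span i ≡ just b → lookup v i ≡ b × lookup w i ≡ b
      agree i eq = common-just _ _ (trans (sym (lookup∘tabulate _ i)) eq)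

    outmap-≡ : ∀ i → lookup span i ≡ nothing → outmap O v i ≡ outmap O w i
    outmap-≡ i free = xor-≢-≢ (lookup v i) (lookup w i) _ _ v≢wᵢ λ eq → ¬sep (i , v≢wᵢ , eq)
      where
      v≢wᵢ = common-nothing _ _ (trans (sym (lookup∘tabulate _ i)) free)

    A : Vec Bool k
    A = tabulate (outmap O v)

    uniq : ∀ {y} → HasOutmap O A span y → _ ≡ y
    uniq = proj₂ (proj₂
      (⊕-connected UniqueOutmap uniqueOutmap-⊕ (replicate k false) A zero-unique span))

  -- Two vertices of `f` differ only in free coordinates of `f`, where both outmaps equal `A`; a
  -- separating coordinate would make them differ.
  separating⇒unique : Separating → ∀ {A f v w} →
                      HasOutmap O A f v → HasOutmap O A f w → v ≡ w
  separating⇒unique sep {A} {f} {v} {w} (v∈f , v-out) (w∈f , w-out) =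
    lookup-ext equal
    where
    free : ∀ i → lookup v i ≢ lookup w i → lookup f i ≡ nothing
    free i v≢wᵢ with lookup f i in fᵢ
    ... | nothing = refl
    ... | just b  = contradiction (trans (v∈f i b fᵢ) (sym (w∈f i b fᵢ))) v≢wᵢ
    equal : ∀ i → lookup v i ≡ lookup w i
    equal i with lookup v i ≟ lookup w i
    ... | yes eq = eq
    ... | no ≢ᵢ  =
      let j , sepⱼ@(≢ⱼ , _) = sep v w (≢ᵢ ∘ cong (λ x → lookup x i))
          freeⱼ = free j ≢ⱼ
      in contradiction (trans (v-out j freeⱼ) (sym (w-out j freeⱼ))) (separated⇒outmap-≢ v w sepⱼ)

  -- If the solutions on both facets along i fail at i, then their outmaps agree
  -- at i too, and they solve the problem for A ⊕ i on f.
  separating⇒exists : Separating → ∀ A f → ∃ (HasOutmap O A f)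
  separating⇒exists sep A = face-induction _ vertex split
    where
    vertex : ∀ v → ∃ (HasOutmap O A (map just v))
    vertex v = v , v∈ , free
      where
      v∈ : v ∈ᶠ map just v
      v∈ i b eq with refl ← trans (sym (lookup-map i just v)) eq = refl
      free : ∀ i → lookup (map just v) i ≡ nothing → _
      free i eq with () ← trans (sym (lookup-map i just v)) eq

    split : ∀ f i → lookup f i ≡ nothing → (∀ b → ∃ (HasOutmap O A (f [ i ]≔ just b))) →
            ∃ (HasOutmap O A f)
    split f i fᵢ facet = choose (facet false) (facet true)
      where
      wrong : ∀ {c v} → HasOutmap O A (f [ i ]≔ just c) v → outmap O v i ≢ lookup A i →
              HasOutmap O (A ⊕ i) f v
      wrong v-out ≢A = fromFacet (λ j j≢i → sym (lookup-⊕′ A j≢i)) fᵢ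
                                 (trans (¬-not ≢A) (sym (lookup-⊕ A i))) v-out
      choose : ∃ (HasOutmap O A (f [ i ]≔ just false)) →
               ∃ (HasOutmap O A (f [ i ]≔ just true)) → ∃ (HasOutmap O A f)
      choose (v , v-out) (w , w-out) with outmap O v i ≟ lookup A i | outmap O w i ≟ lookup A i
      ... | yes eq | _      = v , fromFacet (λ _ _ → refl) fᵢ eq v-out
      ... | no _   | yes eq = w , fromFacet (λ _ _ → refl) fᵢ eq w-out
      ... | no v≢A | no w≢A
        -- Uniqueness for `A ⊕ i` identifies the two solutions, although they lie in opposite
        -- facets.
        with v≡w ← separating⇒unique sep (wrong v-out v≢A) (wrong w-out w≢A)
        with () ← trans (sym (facet-coordinate f i v-out))
                        (trans (cong (λ x → lookup x i) v≡w) (facet-coordinate f i w-out))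

  separating⇒uso : Separating → IsUSO O
  separating⇒uso sep = orientation , unique
    where
    orientation : IsOrientation O
    orientation v i
      -- The two ends of an i-edge differ only at `i`, so `i` must separate them, which makes their
      -- direction bits agree.
      with sep v (v ⊕ i) (λ eq → not-¬ refl (trans (cong (λ x → lookup x i) eq) (lookup-⊕ v i)))
    ... | j , ≢ⱼ , eq with j Fin.≟ i
    ...   | yes refl = eq
    ...   | no j≢i   = contradiction (sym (lookup-⊕′ v j≢i)) ≢ⱼ
    unique : ∀ f → ∃! _≡_ (IsSinkOf O f)
    unique f =
      let v , v-out = separating⇒exists sep (replicate k false) f in
      v , Equivalence.from (sink⇔zeroOutmap f v) v-out ,
      λ {w} sink → separating⇒unique sep v-out (Equivalence.to (sink⇔zeroOutmap f w) sink)

-- Flipping sets of h-edges.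

edgeAt-⊕ : ∀ (v : Vertex k) h → edgeAt (v ⊕ h) h ≡ edgeAt v h
edgeAt-⊕ v h = mkEdge-cong (updateAt-updateAt h v)
  where
  mkEdge-cong : ∀ {u w : Vertex _} .{p : lookup u h ≡ false} .{q : lookup w h ≡ false} →
                u ≡ w → mkEdge u p ≡ mkEdge w q
  mkEdge-cong refl = refl

lookup-flip : ∀ (K : OrientationMap k) h P v →
              lookup (flip K h P v) h ≡ P (edgeAt v h) xor lookup (K v) h
lookup-flip K h P v with P (edgeAt v h)
... | true  = lookup-⊕ (K v) h
... | false = refl

lookup-flip′ : ∀ (K : OrientationMap k) h P v {i} → i ≢ h →
               lookup (flip K h P v) i ≡ lookup (K v) i
lookup-flip′ K h P v i≢h with P (edgeAt v h)
... | true  = lookup-⊕′ (K v) i≢h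
... | false = refl

SeparatedOff : OrientationMap k → Fin k → Vertex k → Vertex k → Set
SeparatedOff K h v w = ∃[ i ] (i ≢ h × SeparatedAt K v w i)

-- For a separating `K` the second alternative matters only when `h` is the sole separating
-- coordinate: if the two h-edges point opposite ways, `separatedOff` yields the first.
Flippable : OrientationMap k → (h : Fin k) → EdgeSet h → Set
Flippable K h P = ∀ v w → lookup v h ≢ lookup w h →
                  SeparatedOff K h v w ⊎ P (edgeAt v h) ≡ P (edgeAt w h)

separatedOff : ∀ (K : OrientationMap k) {h} v w → Separating K →
               lookup v h ≢ lookup w h → lookup (K v) h ≢ lookup (K w) h →
               SeparatedOff K h v w
separatedOff K {h} v w sep ≢ₕ K≢ =
  let i , sepᵢ@(_ , eq) = sep v w (≢ₕ ∘ cong (λ x → lookup x h))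
  in i , distinct-indices (K v) (K w) eq K≢ , sepᵢ

-- Flipping h-edges leaves every separation off `h` intact. A separation at `h` survives exactly
-- when `P` contains both h-edges or neither.
flip-uso⇔flippable : ∀ (K : OrientationMap k) → Separating K → ∀ h P →
                     IsUSO (flip K h P) ⇔ Flippable K h P
flip-uso⇔flippable K sep h P =
  mk⇔ (to ∘ uso⇒separating (flip K h P)) (separating⇒uso (flip K h P) ∘ from)
  where
  to : Separating (flip K h P) → Flippable K h P
  to flip-sep v w ≢ₕ with lookup (K v) h ≟ lookup (K w) h
  ... | no K≢ = inj₁ (separatedOff K v w sep ≢ₕ K≢)
  ... | yes K≡ with flip-sep v w (≢ₕ ∘ cong (λ x → lookup x h))
  ...   | i , ≢ᵢ , eq with i Fin.≟ h
  ...     | no i≢h   = inj₁ (i , i≢h , ≢ᵢ ,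
              trans (sym (lookup-flip′ K h P v i≢h)) (trans eq (lookup-flip′ K h P w i≢h)))
  ...     | yes refl = inj₂ (xor-cancelʳ (lookup (K v) h) _ _
              (trans (sym (lookup-flip K h P v))
                (trans eq (trans (lookup-flip K h P w) (cong (P (edgeAt w h) xor_) (sym K≡))))))

  from : Flippable K h P → Separating (flip K h P)
  from flippable v w v≢w with sep v w v≢w
  ... | i , sepᵢ with i Fin.≟ h
  ...   | no i≢h = off (i , i≢h , sepᵢ)
    where
    off : SeparatedOff K h v w → ∃ (SeparatedAt (flip K h P) v w)
    off (i , i≢h , ≢ᵢ , eq) = i , ≢ᵢ ,
      trans (lookup-flip′ K h P v i≢h) (trans eq (sym (lookup-flip′ K h P w i≢h)))
  ...   | yes refl with flippable v w (proj₁ sepᵢ)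
  ...     | inj₁ (j , j≢h , ≢ⱼ , eq) = j , ≢ⱼ ,
              trans (lookup-flip′ K h P v j≢h) (trans eq (sym (lookup-flip′ K h P w j≢h)))
  ...     | inj₂ P≡ = h , proj₁ sepᵢ ,
              trans (lookup-flip K h P v)
                (trans (cong₂ _xor_ P≡ (proj₂ sepᵢ)) (sym (lookup-flip K h P w)))

-- The partial swap and its phases.

shift : Fin k → Bool → Vertex k → Vertex k
shift h b v = if b then v ⊕ h else v

shift-involutive : ∀ (h : Fin k) b v → shift h b (shift h b v) ≡ v
shift-involutive h true  v = ⊕-involutive v h
shift-involutive h false v = refl

edgeAt-shift : ∀ (h : Fin k) b v → edgeAt (shift h b v) h ≡ edgeAt v h
edgeAt-shift h true  v = edgeAt-⊕ v h
edgeAt-shift h false v = refl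

lookup-shift′ : ∀ {h : Fin k} b v {i} → i ≢ h → lookup (shift h b v) i ≡ lookup v i
lookup-shift′ true  v i≢h = lookup-⊕′ v i≢h
lookup-shift′ false v i≢h = refl

-- For a fixed bit, the shift is the identity or the reflection in `h`, and so acts on both vertices
-- by the same automorphism of the cube.
shift-≡ : ∀ (h : Fin k) b v w i → lookup v i ≡ lookup w i →
          lookup (shift h b v) i ≡ lookup (shift h b w) i
shift-≡ h false v w i eq = eq
shift-≡ h true  v w i eq with i Fin.≟ h
... | yes refl = trans (lookup-⊕ v h) (trans (cong not eq) (sym (lookup-⊕ w h)))
... | no i≢h   = trans (lookup-⊕′ v i≢h) (trans eq (sym (lookup-⊕′ w i≢h)))

shift-≢ : ∀ (h : Fin k) b v w i → lookup v i ≢ lookup w i →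
          lookup (shift h b v) i ≢ lookup (shift h b w) i
shift-≢ h b v w i ≢ᵢ eq =
  ≢ᵢ (subst₂ (λ x y → lookup x i ≡ lookup y i)
             (shift-involutive h b v) (shift-involutive h b w)
             (shift-≡ h b (shift h b v) (shift h b w) i eq))

lookup-shift-orientation : ∀ (K : OrientationMap k) → IsOrientation K → ∀ h b v →
                           lookup (K (shift h b v)) h ≡ lookup (K v) h
lookup-shift-orientation K orientation h true  v = sym (orientation v h)
lookup-shift-orientation K orientation h false v = refl

-- The graph of `partialSwap`, which, unlike the function, is symmetric without
-- function extensionality.
Swapped : Fin k → OrientationMap k → OrientationMap k → Set
Swapped h K L = ∀ v → L v ≡ K (shift h (lookup (K v) h) v)

partialSwap-swapped : ∀ (K : OrientationMap k) h → Swapped h K (partialSwap K h)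
partialSwap-swapped K h v with lookup (K v) h
... | true  = refl
... | false = refl

module _ {h : Fin k} (K L : OrientationMap k) (orientation : IsOrientation K)
         (swapped : Swapped h K L) where

  swapped-lookup : ∀ v → lookup (L v) h ≡ lookup (K v) h
  swapped-lookup v = trans (cong (λ x → lookup x h) (swapped v))
                           (lookup-shift-orientation K orientation h _ v)

  -- The partial swap is an involution: it keeps the directions of the h-edges, so a second swap
  -- shifts each vertex by the same bit.
  swapped-sym : Swapped h L K
  swapped-sym v rewrite swapped-lookup v = sym (begin
    L (shift h b v)                                        ≡⟨ swapped (shift h b v) ⟩
    K (shift h (lookup (K (shift h b v)) h) (shift h b v)) ≡⟨ cong (λ c → K (shift h c (shift h b v))) b≡ ⟩
    K (shift h b (shift h b v))                            ≡⟨ cong K (shift-involutive h b v) ⟩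
    K v                                                    ∎)
    where
    open ≡-Reasoning
    b : Bool
    b = lookup (K v) h
    b≡ : lookup (K (shift h b v)) h ≡ b
    b≡ = lookup-shift-orientation K orientation h b v

  -- A variable bit lets two vertices whose h-edges point the same way be shifted by one common bit.
  swapped-≡ : ∀ {v b} → lookup (K v) h ≡ b → L v ≡ K (shift h b v)
  swapped-≡ {v} refl = swapped v

  swapped-separatedAt : ∀ v w {b c i} → lookup (K v) h ≡ b → lookup (K w) h ≡ c →
                        lookup v i ≢ lookup w i →
                        lookup (K (shift h b v)) i ≡ lookup (K (shift h c w)) i →
                        SeparatedAt L v w i
  swapped-separatedAt v w {i = i} Kv≡b Kw≡c ≢ᵢ eq = ≢ᵢ ,
    trans (cong (λ x → lookup x i) (swapped-≡ Kv≡b))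
      (trans eq (cong (λ x → lookup x i) (sym (swapped-≡ Kw≡c))))

  -- The shifted vertices keep their opposite directions at `h`, so `K` separates them at another
  -- coordinate, which shifting does not touch.
  swapped-separatedOff : Separating K → ∀ v w → lookup (K v) h ≢ lookup (K w) h →
                         SeparatedOff L h v w
  swapped-separatedOff sep v w K≢ =
    let i , ≢ᵢ , eq = sep v′ w′ (K′≢ ∘ cong (λ x → lookup (K x) h))
        i≢h = distinct-indices (K v′) (K w′) eq K′≢
        v′≡v = lookup-shift′ (lookup (K v) h) v i≢h
        w′≡w = lookup-shift′ (lookup (K w) h) w i≢h
    in i , i≢h ,
       swapped-separatedAt v w refl refl (λ v≡w → ≢ᵢ (trans v′≡v (trans v≡w (sym w′≡w)))) eq
    where
    v′ w′ : Vertex k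
    v′ = shift h (lookup (K v) h) v
    w′ = shift h (lookup (K w) h) w
    K′≢ : lookup (K v′) h ≢ lookup (K w′) h
    K′≢ = subst₂ _≢_ (sym (lookup-shift-orientation K orientation h _ v))
                     (sym (lookup-shift-orientation K orientation h _ w)) K≢

  -- Through the criterion, this is the known fact that a partial swap of a USO is a USO. If the
  -- h-edges point the same way, a common shift reduces the claim to `K`.
  swapped-separating : Separating K → Separating L
  swapped-separating sep v w v≢w with lookup (K v) h ≟ lookup (K w) h
  ... | no K≢ = let i , _ , sepᵢ = swapped-separatedOff sep v w K≢ in i , sepᵢ
  ... | yes K≡ =
    let b = lookup (K w) h
        i , ≢ᵢ , eq = sep (shift h b v) (shift h b w) λ s≡ → v≢w
          (trans (sym (shift-involutive h b v))
            (trans (cong (shift h b) s≡) (shift-involutive h b w)))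
    in i , swapped-separatedAt v w K≡ refl (≢ᵢ ∘ shift-≡ h b v w i) eq

  -- A pair with opposite h-directions is separated off `h` in `L`. For any other pair the
  -- hypothesis is applied to the shifted pair, which lies on the same h-edges.
  swapped-flippable : Separating K → ∀ P → Flippable K h P → Flippable L h P
  swapped-flippable sep P flippable v w ≢ₕ with lookup (K v) h ≟ lookup (K w) h
  ... | no K≢ = inj₁ (swapped-separatedOff sep v w K≢)
  ... | yes K≡ with flippable (shift h b v) (shift h b w) (shift-≢ h b v w h ≢ₕ)
    where b = lookup (K w) h
  ...   | inj₁ (i , i≢h , ≢ᵢ , eq) =
            inj₁ (i , i≢h ,
                  swapped-separatedAt v w K≡ refl (≢ᵢ ∘ shift-≡ h (lookup (K w) h) v w i) eq)
  ...   | inj₂ P≡ = inj₂ (trans (cong P (sym (edgeAt-shift h _ v)))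
                           (trans P≡ (cong P (edgeAt-shift h _ w))))

-- The orientation enters the definition of a phase only through the flips that give a USO, so the
-- same partition serves both.
isPhase-resp-flips : ∀ {h : Fin k} {K L : OrientationMap k} →
                     (∀ P → IsUSO (flip L h P) ⇔ IsUSO (flip K h P)) →
                     ∀ {B} → IsPhase K h B → IsPhase L h B
isPhase-resp-flips same (R , partition , block) = R , partition′ , block
  where
  open IsPhasePartition partition
  partition′ : IsPhasePartition _ _ R
  partition′ = record
    { isDecEquivalence = isDecEquivalence
    ; flip-uso⇔union   = λ P → ⇔.trans (same P) (flip-uso⇔union P)
    }

lemma27 : ∀ (k : ℕ) (K : OrientationMap k) → IsUSO K → (h : Fin k) →
    ∀ (B : EdgeSet h) → IsPhase (partialSwap K h) h B ⇔ IsPhase K h B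
lemma27 k K uso h B = mk⇔ (isPhase-resp-flips same) (isPhase-resp-flips (⇔.sym ∘ same))
  where
  K′ : OrientationMap k
  K′ = partialSwap K h
  sep : Separating K
  sep = uso⇒separating K uso
  swapped : Swapped h K K′
  swapped = partialSwap-swapped K h
  sep′ : Separating K′
  sep′ = swapped-separating K K′ (proj₁ uso) swapped sep
  same : ∀ P → IsUSO (flip K h P) ⇔ IsUSO (flip K′ h P)
  same P = ⇔.trans (flip-uso⇔flippable K sep h P) (⇔.trans
    (mk⇔ (swapped-flippable K K′ (proj₁ uso) swapped sep P)
         -- The converse exchanges the roles, `K` being the partial swap of `K′`; that `K′` is an
         -- orientation comes from the criterion.
         (swapped-flippable K′ K (proj₁ (separating⇒uso K′ sep′))
                            (swapped-sym K K′ (proj₁ uso) swapped) sep′ P))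
    (⇔.sym (flip-uso⇔flippable K′ sep′ h P)))
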